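{- Let $s\ge 0$ be an integer and let $P$ be a class-$s$ 0-1 matrix with at least one 1-entry. Then \[ \mathrm{ex}(n,P)\le n\,2^{O\left(\log^{\frac{s}{s+1}} n\right)}, \] where the implied constant depends only on $P$.
   Context: $\log$ is the binary logarithm. A 0-1 matrix $A$ contains a 0-1 matrix $B$ if $B$ can be obtained from $A$ by deleting some rows, some columns, and changing some 1-entries to 0-entries. For a 0-1 matrix $P$ with at least one 1-entry, $\mathrm{ex}(n,P)$ is the maximum number of 1-entries in an $n\times n$ 0-1 matrix that does not contain $P$. An $l\times k$ 0-1 matrix $P$ is split by a vertical separation at $a\in[l-1]$ into its first $a$ rows and its last $l-a$ rows if for all but at most one column $y$, either $P(x,y)=0$ for all $x\le a$ or $P(x,y)=0$ for all $x>a$. A 0-1 matrix is class-$0$ if it has a single row; for $s>0$ it is class-$s$ if it has a single row or it can be partitioned by a vertical separation into two class-$(s-1)$ matrices. -}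

module Defs where

open import Data.Nat using (ℕ; zero; suc; _+_; _*_; _^_; _≤_)
open import Data.Nat.Logarithm using (⌈log₂_⌉)
open import Data.Fin using (Fin; _<_; _↑ˡ_; _↑ʳ_)
open import Data.Fin.Patterns using (0F)
open import Data.Bool using (Bool; true; false)
open import Data.Product using (Σ; ∃; ∃-syntax; _×_)
open import Relation.Binary.PropositionalEquality using (_≡_)

Matrix : ℕ → ℕ → Set
Matrix l k = Fin l → Fin k → Bool

countRow : ∀ {k} → (Fin k → Bool) → ℕ
countRow {zero}  r = 0
countRow {suc k} r with r 0F
... | true  = suc (countRow (λ j → r (Fin.suc j)))
  where import Data.Fin as Fin
... | false = countRow (λ j → r (Fin.suc j))
  where import Data.Fin as Fin

ones : ∀ {l k} → Matrix l k → ℕ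
ones {zero}  A = 0
ones {suc l} A = countRow (A 0F) + ones (λ i → A (Data.Fin.suc i))
  where import Data.Fin

HasOne : ∀ {l k} → Matrix l k → Set
HasOne P = ∃[ i ] ∃[ j ] P i j ≡ true

StrictlyIncreasing : ∀ {m n} → (Fin m → Fin n) → Set
StrictlyIncreasing f = ∀ {i j} → i < j → f i < f j

-- A contains B: B is obtained from A by deleting rows and columns and
-- turning some 1-entries into 0-entries.
Contains : ∀ {m n l k} → Matrix m n → Matrix l k → Set
Contains {m} {n} {l} {k} A B =
  Σ (Fin l → Fin m) λ f → Σ (Fin k → Fin n) λ g →
    StrictlyIncreasing f × StrictlyIncreasing g ×
    (∀ i j → B i j ≡ true → A (f i) (g j) ≡ true)

Avoids : ∀ {m n l k} → Matrix m n → Matrix l k → Set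
Avoids A B = Contains A B → Data.Empty.⊥
  where import Data.Empty

-- "ex(n,P) ≤ b": every n×n 0-1 matrix not containing P has at most b 1-entries.
-- (ex(n,P) is the maximum of these finitely many counts, so this is exactly ex(n,P) ≤ b.)
ExAtMost : ∀ {l k} → ℕ → Matrix l k → ℕ → Set
ExAtMost n P b = (A : Matrix n n) → Avoids A P → ones A ≤ b

topRows : ∀ {a b k} → Matrix (a + b) k → Matrix a k
topRows {a} {b} P i y = P (i ↑ˡ b) y

bottomRows : ∀ {a b k} → Matrix (a + b) k → Matrix b k
bottomRows {a} {b} P i y = P (a ↑ʳ i) y

Straddles : ∀ {a b k} → Matrix (a + b) k → Fin k → Set
Straddles {a} {b} P y =
  (∃[ i ] topRows {a} {b} P i y ≡ true) × (∃[ i ] bottomRows {a} {b} P i y ≡ true)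

VSep : ∀ a b {k} → Matrix (a + b) k → Set
VSep a b {k} P = ∀ (y y' : Fin k) → Straddles {a} {b} P y → Straddles {a} {b} P y' → y ≡ y'

data Class : ℕ → ∀ {l k} → Matrix l k → Set where
  single : ∀ s {k} (P : Matrix 1 k) → Class s P
  split  : ∀ s {a b k} (P : Matrix (a + b) k) → 1 ≤ a → 1 ≤ b → VSep a b P →
           Class s (topRows {a} {b} P) → Class s (bottomRows {a} {b} P) →
           Class (suc s) P

{-# OPTIONS --safe #-}
module Submission where

-- Cut rows and columns into nested blocks ("cells") of lengths 1, M, M ², …, M ^ S ≥ n.
-- Fix a colour, a sequence of row scales 0 ≤ j₁ ≤ … ≤ S, one per level of the class
-- hierarchy, and a shape, that is k sub-blocks of a column block. Repeatedly delete the
-- entries whose column does not continue both above and below them in another small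
-- cell of the same large cell; every entry left extends to a copy of P, with the two
-- halves of each separation joined through their common column.
--
-- Call an entry bad if for every colour some shape deletes it. Along a fixed column a deleted
-- entry has its small cell determined by its large cell, so following for each bad
-- entry the finest scale reached in this way shows that bad entries are few, a power of M
-- and S per column. If a row had too many good entries, some column block would
-- have k sub-blocks with good entries of the same colour; none of these would ever be
-- deleted for the corresponding shape, so P would occur. Taking M = 2 ^ S ^ s with S ^ (s + 1) ≈ log n
-- balances the two counts.

open import Defs
open import Data.Nat using (ℕ; zero; suc; _+_; _*_; _^_; _∸_; _≤_; z≤n; s≤s; NonZero; ⌈_/2⌉)
import Data.Nat as ℕ
open import Data.Nat.Properties
open import Data.Nat.DivMod
open import Data.Nat.Induction using (<-rec)
open import Data.Nat.Logarithm using (⌈log₂_⌉; ⌈log₂⌉-mono-≤; ⌈log₂⌈n/2⌉⌉≡⌈log₂n⌉∸1)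
open import Data.Bool using (Bool; true; false; _∧_; _∨_; not)
import Data.Bool.Properties as Bool
open import Data.Fin using (Fin; toℕ; _↑ˡ_; _↑ʳ_; splitAt; join; combine; remQuot; fromℕ<;
    inject₁; finToFun; funToFin)
  renaming (zero to fzero; suc to fsuc; _<_ to _<ᶠ_)
open import Data.Fin.Properties using (any?; all?; toℕ-injective; ¬Fin0; toℕ<n; toℕ-fromℕ<;
    toℕ-inject₁; toℕ-↑ˡ; toℕ-↑ʳ; splitAt-↑ˡ; splitAt-↑ʳ; join-splitAt; remQuot-combine;
    finToFun-funToFin; ¬∀⟶∃¬)
  renaming (suc-injective to fsuc-injective)
import Data.Fin.Properties as Finₚ
open import Data.Vec using (Vec; []; _∷_)
open import Data.Product using (Σ; ∃; ∃-syntax; _×_; _,_; proj₁; proj₂)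
open import Data.Sum using (_⊎_; inj₁; inj₂)
open import Data.Empty using (⊥; ⊥-elim)
open import Function using (_∘_; const)
open import Relation.Nullary using (¬_; Dec; yes; no; does)
open import Relation.Nullary.Decidable using (dec-true; _×-dec_; _⊎-dec_)
open import Relation.Binary.Definitions using (tri<; tri≈; tri>)
open import Relation.Binary.PropositionalEquality
open import Algebra.Properties.CommutativeSemigroup +-commutativeSemigroup
  using (interchange; x∙yz≈y∙xz)
open import Algebra.Properties.CommutativeSemigroup *-commutativeSemigroup
  using (xy∙z≈xz∙y) renaming (interchange to *-interchange; x∙yz≈y∙xz to *-x∙yz≈y∙xz)

-- Booleans and counting: subsets, union bounds, row and column sums.

false≢true : false ≡ true → ⊥
false≢true ()

does-sound : ∀ {a} {A : Set a} (a? : Dec A) → does a? ≡ true → A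
does-sound (yes a) _ = a

∧-elimˡ : ∀ {x y} → x ∧ y ≡ true → x ≡ true
∧-elimˡ {true} _ = refl

∧-elimʳ : ∀ {x y} → x ∧ y ≡ true → y ≡ true
∧-elimʳ {true} y = y

∧-intro : ∀ {x y} → x ≡ true → y ≡ true → x ∧ y ≡ true
∧-intro refl y = y

∨-elim : ∀ {x y} → x ∨ y ≡ true → x ≡ true ⊎ y ≡ true
∨-elim {true}  _ = inj₁ refl
∨-elim {false} y = inj₂ y

count-split : ∀ {n} (p q₁ q₂ : Fin n → Bool) →
  (∀ r → p r ≡ true → q₁ r ≡ true ⊎ q₂ r ≡ true) →
  countRow p ≤ countRow q₁ + countRow q₂
count-split {zero} p q₁ q₂ h = z≤n
count-split {suc n} p q₁ q₂ h
  with p fzero | q₁ fzero | q₂ fzero | h fzero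
     | count-split (p ∘ fsuc) (q₁ ∘ fsuc) (q₂ ∘ fsuc) (h ∘ fsuc)
... | false | false | false | _ | ih = ih
... | false | false | true  | _ | ih = ≤-trans ih (+-monoʳ-≤ _ (n≤1+n _))
... | false | true  | false | _ | ih = m≤n⇒m≤1+n ih
... | false | true  | true  | _ | ih = m≤n⇒m≤1+n (≤-trans ih (+-monoʳ-≤ _ (n≤1+n _)))
... | true  | true  | false | _ | ih = s≤s ih
... | true  | true  | true  | _ | ih = s≤s (≤-trans ih (+-monoʳ-≤ _ (n≤1+n _)))
... | true  | false | true  | _ | ih = ≤-trans (s≤s ih) (≤-reflexive (sym (+-suc _ _)))
... | true  | false | false | e | ih with e refl
... | inj₁ ()
... | inj₂ ()

count-empty : ∀ {n} (p : Fin n → Bool) → (∀ r → p r ≡ true → ⊥) → countRow p ≡ 0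
count-empty {zero} p h = refl
count-empty {suc n} p h with p fzero in eq
... | true  = ⊥-elim (h fzero eq)
... | false = count-empty (p ∘ fsuc) (h ∘ fsuc)

count-full : ∀ n → countRow {n} (const true) ≡ n
count-full zero    = refl
count-full (suc n) = cong suc (count-full n)

count-subsingleton : ∀ {n} (p : Fin n → Bool) →
  (∀ r r' → p r ≡ true → p r' ≡ true → r ≡ r') → countRow p ≤ 1
count-subsingleton {zero} p h = z≤n
count-subsingleton {suc n} p h with p fzero in eq
... | true  = s≤s (≤-reflexive (count-empty (p ∘ fsuc) λ r pr → Finₚ.0≢1+n (h fzero (fsuc r) eq pr)))
... | false = count-subsingleton (p ∘ fsuc) λ r r' pr pr' → fsuc-injective (h (fsuc r) (fsuc r') pr pr')

increasing-choice : ∀ {n} k (p : Fin n → Bool) → k ≤ countRow p →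
  Σ (Fin k → Fin n) λ f → StrictlyIncreasing f × (∀ i → p (f i) ≡ true)
increasing-choice zero p _ = (λ ()) , (λ { {()} }) , λ ()
increasing-choice {suc n} (suc k) p h with p fzero in eq
... | false with increasing-choice (suc k) (p ∘ fsuc) h
...   | f , inc , pf = fsuc ∘ f , (λ i<j → s≤s (inc i<j)) , pf
increasing-choice {suc n} (suc k) p (s≤s h) | true with increasing-choice k (p ∘ fsuc) h
...   | f , inc , pf = f' , inc' , pf'
  where
  f' : Fin (suc k) → Fin (suc n)
  f' fzero    = fzero
  f' (fsuc i) = fsuc (f i)
  inc' : StrictlyIncreasing f'
  inc' {fzero}  {fsuc j} _         = s≤s z≤n
  inc' {fsuc i} {fsuc j} (s≤s i<j) = s≤s (inc i<j)
  pf' : ∀ i → p (f' i) ≡ true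
  pf' fzero    = eq
  pf' (fsuc i) = pf i

module _ {n N : ℕ} (D : Fin (suc N) → Bool) (R : Fin (suc N) → Fin n → Set) where

  private
    Pick : Fin n → Set
    Pick r = ∃[ e ] D e ≡ true × R e r

    isFirst : ∀ {r} b → (b ≡ true → Pick r) → Bool
    isFirst false _ = false
    isFirst true h with proj₁ (h refl)
    ... | fzero  = true
    ... | fsuc _ = false

    isFirst-sound : ∀ {r} b (h : b ≡ true → Pick r) → isFirst b h ≡ true →
      b ≡ true × D fzero ≡ true × R fzero r
    isFirst-sound true h eq with h refl
    ... | fzero , d , x = refl , d , x

    isFirst-else : ∀ {r} b (h : b ≡ true → Pick r) → isFirst b h ≡ false → b ≡ true →
      ∃[ e ] D (fsuc e) ≡ true × R (fsuc e) r
    isFirst-else true h eq _ with h refl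
    ... | fsuc e , d , x = e , d , x

  -- `R` is not assumed decidable, so `p₀` collects the `r` whose supplied witness has index zero; a
  -- related `r` with another witness stays in `p₁`.
  peel : (p : Fin n → Bool) → (∀ r → p r ≡ true → ∃[ e ] D e ≡ true × R e r) →
    Σ (Fin n → Bool) λ p₀ → Σ (Fin n → Bool) λ p₁ →
      (countRow p ≤ countRow p₀ + countRow p₁) ×
      (∀ r → p₀ r ≡ true → p r ≡ true × D fzero ≡ true × R fzero r) ×
      (∀ r → p₁ r ≡ true → p r ≡ true × ∃[ e ] D (fsuc e) ≡ true × R (fsuc e) r)
  peel p h = p₀ , p₁ , count-split p p₀ p₁ cover , (λ r → isFirst-sound (p r) (h r)) , rest
    where
    p₀ p₁ : Fin n → Bool
    p₀ r = isFirst (p r) (h r)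
    p₁ r = p r ∧ not (p₀ r)
    cover : ∀ r → p r ≡ true → p₀ r ≡ true ⊎ p₁ r ≡ true
    cover r pr with p₀ r
    ... | true  = inj₁ refl
    ... | false = inj₂ (∧-intro pr refl)
    rest : ∀ r → p₁ r ≡ true → p r ≡ true × ∃[ e ] D (fsuc e) ≡ true × R (fsuc e) r
    rest r h₁ = ∧-elimˡ h₁ , isFirst-else (p r) (h r) (not-true (p₀ r) (∧-elimʳ {p r} h₁)) (∧-elimˡ h₁)
      where
      not-true : ∀ b → not b ≡ true → b ≡ false
      not-true false _ = refl

-- Induction on `N`, peeling off one index at a time; only indices marked by `D` contribute. The
-- size hypothesis ranges over all Boolean subsets `q` of a fibre because the fibre of an arbitrary
-- relation need not itself be given by a Boolean function.
fibre-bound : ∀ {n} N (D : Fin N → Bool) (R : Fin N → Fin n → Set) b (p : Fin n → Bool) →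
  (∀ r → p r ≡ true → ∃[ e ] D e ≡ true × R e r) →
  (∀ e (q : Fin n → Bool) → (∀ r → q r ≡ true → p r ≡ true × R e r) → countRow q ≤ b) →
  countRow p ≤ countRow D * b
fibre-bound zero D R b p h _ = ≤-reflexive (count-empty p λ r pr → ¬Fin0 (proj₁ (h r pr)))
fibre-bound (suc N) D R b p h small with peel D R p h
... | p₀ , p₁ , le , h₀ , h₁
  with fibre-bound N (D ∘ fsuc) (R ∘ fsuc) b p₁ (λ r pr → proj₂ (h₁ r pr))
         (λ e q hq → small (fsuc e) q λ r qr → proj₁ (h₁ r (proj₁ (hq r qr))) , proj₂ (hq r qr))
     | D fzero
... | ih | true  = ≤-trans le (+-mono-≤ (small fzero p₀ λ r pr → proj₁ (h₀ r pr) , proj₂ (proj₂ (h₀ r pr))) ih)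
... | ih | false = ≤-trans le (≤-trans (+-monoˡ-≤ _ (≤-reflexive (count-empty p₀ λ r pr → false≢true (proj₁ (proj₂ (h₀ r pr)))))) ih)

union-bound : ∀ {n} N (R : Fin N → Fin n → Set) b (p : Fin n → Bool) →
  (∀ r → p r ≡ true → ∃[ e ] R e r) →
  (∀ e (q : Fin n → Bool) → (∀ r → q r ≡ true → p r ≡ true × R e r) → countRow q ≤ b) →
  countRow p ≤ N * b
union-bound N R b p h small = subst (λ x → countRow p ≤ x * b) (count-full N)
  (fibre-bound N (const true) R b p (λ r pr → proj₁ (h r pr) , refl , proj₂ (h r pr)) small)

ones-transpose : ∀ {l k} (A : Matrix l k) → ones A ≡ ones (λ j i → A i j)
ones-transpose {zero} {k} A = sym (zeros (λ (j : Fin k) i → A i j))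
  where
  zeros : ∀ {k} (B : Matrix k 0) → ones B ≡ 0
  zeros {zero}  B = refl
  zeros {suc k} B = zeros (B ∘ fsuc)
ones-transpose {suc l} A = trans (cong (countRow (A fzero) +_) (ones-transpose (A ∘ fsuc)))
  (sym (columns (λ j i → A i j)))
  where
  columns : ∀ {k} (B : Matrix k (suc l)) →
    ones B ≡ countRow (λ j → B j fzero) + ones (λ j → B j ∘ fsuc)
  columns {zero} B = refl
  columns {suc k} B with B fzero fzero | columns (B ∘ fsuc)
  ... | true  | ih = cong suc (trans (cong (countRow (B fzero ∘ fsuc) +_) ih) (x∙yz≈y∙xz (countRow (B fzero ∘ fsuc)) (countRow (λ j → B (fsuc j) fzero)) _))
  ... | false | ih = trans (cong (countRow (B fzero ∘ fsuc) +_) ih) (x∙yz≈y∙xz (countRow (B fzero ∘ fsuc)) (countRow (λ j → B (fsuc j) fzero)) _)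

ones-rows : ∀ {l k} b (A : Matrix l k) → (∀ i → countRow (A i) ≤ b) → ones A ≤ l * b
ones-rows {zero}  b A h = z≤n
ones-rows {suc l} b A h = +-mono-≤ (h fzero) (ones-rows b (A ∘ fsuc) (h ∘ fsuc))

ones-split : ∀ {l k} (A B C : Matrix l k) →
  (∀ i j → A i j ≡ true → B i j ≡ true ⊎ C i j ≡ true) → ones A ≤ ones B + ones C
ones-split {zero}  A B C h = z≤n
ones-split {suc l} A B C h = ≤-trans
  (+-mono-≤ (count-split _ _ _ (h fzero)) (ones-split (A ∘ fsuc) (B ∘ fsuc) (C ∘ fsuc) (h ∘ fsuc)))
  (≤-reflexive (interchange (countRow (B fzero)) (countRow (C fzero)) _ _))

-- Nested cells and their base-`M` digits.

module Grid (n M : ℕ) .{{_ : NonZero M}} where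

  -- cell j r = r / M ^ j indexes the block of length M ^ j containing r; rows and columns share it.
  cell : ℕ → Fin n → ℕ
  cell zero    r = toℕ r
  cell (suc j) r = cell j r / M

  digit : ℕ → Fin n → Fin M
  digit j r = cell j r mod M

  cell-mono : ∀ j {r r'} → toℕ r ≤ toℕ r' → cell j r ≤ cell j r'
  cell-mono zero    h = h
  cell-mono (suc j) h = /-monoˡ-≤ M (cell-mono j h)

  cell-<⇒< : ∀ j {r r'} → cell j r ℕ.< cell j r' → r <ᶠ r'
  cell-<⇒< j {r} {r'} h = ≰⇒> λ r'≤r → <⇒≱ h (cell-mono j r'≤r)

  cell-coarsen : ∀ {i j} → i ≤ j → ∀ {r r'} → cell i r ≡ cell i r' → cell j r ≡ cell j r'
  cell-coarsen {i} i≤j = go (≤⇒≤′ i≤j)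
    where
    go : ∀ {j} → i ℕ.≤′ j → ∀ {r r'} → cell i r ≡ cell i r' → cell j r ≡ cell j r'
    go (ℕ.≤′-reflexive refl) e = e
    go (ℕ.≤′-step h)         e = cong (_/ M) (go h e)

  -- Rows in a common cell stay together at all coarser scales. This recovers the order of two
  -- scales from an entry surviving between them, since a colour may list its scales in any order.
  cell-separates : ∀ {i j r r'} → cell i r ℕ.< cell i r' → cell j r' ≡ cell j r → i ≤ j
  cell-separates {i} {j} lt eq with ≤-total i j
  ... | inj₁ i≤j = i≤j
  ... | inj₂ j≤i = ⊥-elim (<⇒≢ lt (sym (cell-coarsen j≤i eq)))

  cell≡digit : ∀ j r → cell j r ≡ toℕ (digit j r) + cell (suc j) r * M
  cell≡digit j r = trans (m≡m%n+[m/n]*n (cell j r) M)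
    (cong (_+ cell (suc j) r * M) (sym (Finₚ.toℕ-fromℕ< (m%n<n (cell j r) M))))

  cell-refine : ∀ j {r r'} → cell (suc j) r ≡ cell (suc j) r' → digit j r ≡ digit j r' →
    cell j r ≡ cell j r'
  cell-refine j {r} {r'} e f = trans (cell≡digit j r)
    (trans (cong₂ (λ x y → toℕ x + y * M) f e) (sym (cell≡digit j r')))

  digit-< : ∀ j {r r'} → cell (suc j) r ≡ cell (suc j) r' → digit j r <ᶠ digit j r' → r <ᶠ r'
  digit-< j {r} {r'} e f = cell-<⇒< j (subst₂ ℕ._<_ (sym (cell≡digit j r)) (sym (cell≡digit j r'))
    (subst (λ x → toℕ (digit j r) + x * M ℕ.< _) (sym e) (+-monoˡ-< _ f)))

  -- After `j` divisions by `M` every index is below `M ^ i` as soon as `n ≤ M ^ (j + i)`; the case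
  -- `i = 0` leaves one cell.
  cell-top : ∀ S → n ≤ M ^ S → ∀ r → cell S r ≡ 0
  cell-top S n≤ r = n<1⇒n≡0 (bound S 0 (subst (λ x → n ≤ M ^ x) (sym (+-identityʳ S)) n≤))
    where
    bound : ∀ j i → n ≤ M ^ (j + i) → cell j r ℕ.< M ^ i
    bound zero    i h = <-≤-trans (toℕ<n r) h
    bound (suc j) i h = m<n*o⇒m/o<n (subst (cell j r ℕ.<_) (*-comm M (M ^ i))
      (bound j (suc i) (subst (λ x → n ≤ M ^ x) (sym (+-suc j i)) h)))

  -- Separation within a column: deleting extreme entries.

  Entries : Set
  Entries = Matrix n n

  _⊆_ : Entries → Entries → Set
  X ⊆ Y = ∀ {r c} → X r c ≡ true → Y r c ≡ true

  -- The strict inequality is between `lo`-cells, not rows: half of `P` can then be placed inside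
  -- the `lo`-cell of `r'`, entirely on one side of the `lo`-cell of `r`.
  Below Above : (lo hi : ℕ) → Entries → Fin n → Fin n → Fin n → Set
  Below lo hi X r c r' = X r' c ≡ true × cell hi r' ≡ cell hi r × cell lo r ℕ.< cell lo r'
  Above lo hi X r c r' = X r' c ≡ true × cell hi r' ≡ cell hi r × cell lo r' ℕ.< cell lo r

  below? : ∀ lo hi X r c → Dec (∃ (Below lo hi X r c))
  below? lo hi X r c = any? λ r' →
    (X r' c Bool.≟ true) ×-dec ((cell hi r' ≟ cell hi r) ×-dec (cell lo r <? cell lo r'))

  above? : ∀ lo hi X r c → Dec (∃ (Above lo hi X r c))
  above? lo hi X r c = any? λ r' →
    (X r' c Bool.≟ true) ×-dec ((cell hi r' ≟ cell hi r) ×-dec (cell lo r' <? cell lo r))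

  sep : (lo hi : ℕ) → Entries → Entries
  sep lo hi X r c = X r c ∧ (does (below? lo hi X r c) ∧ does (above? lo hi X r c))

  sep-⊆ : ∀ {lo hi X} → sep lo hi X ⊆ X
  sep-⊆ = ∧-elimˡ

  sep-below : ∀ {lo hi X r c} → sep lo hi X r c ≡ true → ∃ (Below lo hi X r c)
  sep-below {lo} {hi} {X} {r} {c} h =
    does-sound (below? lo hi X r c) (∧-elimˡ (∧-elimʳ {X r c} h))

  sep-above : ∀ {lo hi X r c} → sep lo hi X r c ≡ true → ∃ (Above lo hi X r c)
  sep-above {lo} {hi} {X} {r} {c} h =
    does-sound (above? lo hi X r c) (∧-elimʳ {does (below? lo hi X r c)} (∧-elimʳ {X r c} h))

  removed : (lo hi : ℕ) → Entries → Entries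
  removed lo hi X r c = X r c ∧ not (sep lo hi X r c)

  sep-keeps : ∀ lo hi X {r c} → X r c ≡ true → removed lo hi X r c ≡ false → sep lo hi X r c ≡ true
  sep-keeps lo hi X {r} {c} x h with X r c | sep lo hi X r c
  sep-keeps _ _ _ refl h | true | true = refl

  -- Membership in the last (`δ` zero) or first (`δ` one) `lo`-cell that `X` occupies in column `c`
  -- inside the `hi`-cell of `r`.
  Extreme : (lo hi : ℕ) → Entries → Fin 2 → Fin n → Fin n → Set
  Extreme lo hi X fzero     r c = X r c ≡ true × ¬ ∃ (Below lo hi X r c)
  Extreme lo hi X (fsuc _) r c = X r c ≡ true × ¬ ∃ (Above lo hi X r c)

  removed⇒extreme : ∀ lo hi X {r c} → removed lo hi X r c ≡ true → ∃[ δ ] Extreme lo hi X δ r c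
  removed⇒extreme lo hi X {r} {c} h with below? lo hi X r c | above? lo hi X r c | h
  ... | no ¬b | _     | h = fzero , ∧-elimˡ h , ¬b
  ... | yes _ | no ¬a | h = fsuc fzero , ∧-elimˡ h , ¬a
  ... | yes _ | yes _ | h = ⊥-elim (kept (X r c) h)
    where
    kept : ∀ x → x ∧ not (x ∧ true) ≡ true → ⊥
    kept true ()

  -- If the `lo`-cells differed, one of the two entries would be the continuation that the other
  -- lacks. So, given the column and the `hi`-cell, a deleted entry has only two possible
  -- `lo`-cells.
  extreme-cell : ∀ {lo hi X} δ {r r' c} → Extreme lo hi X δ r c → Extreme lo hi X δ r' c →
    cell hi r ≡ cell hi r' → cell lo r ≡ cell lo r'
  extreme-cell {lo} δ {r} {r'} x x' e with <-cmp (cell lo r) (cell lo r')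
  extreme-cell δ        x       x'      e | tri≈ _ eq _ = eq
  extreme-cell fzero    (_ , x) (y , _) e | tri< lt _ _ = ⊥-elim (x (_ , y , sym e , lt))
  extreme-cell fzero    (y , _) (_ , x) e | tri> _ _ lt = ⊥-elim (x (_ , y , e , lt))
  extreme-cell (fsuc _) (y , _) (_ , x) e | tri< lt _ _ = ⊥-elim (x (_ , y , e , lt))
  extreme-cell (fsuc _) (_ , x) (y , _) e | tri> _ _ lt = ⊥-elim (x (_ , y , sym e , lt))

  -- The filter of one shape and the entries it deletes.

  module Blocks {k : ℕ} (w : ℕ) (d : Fin k → Fin M) where

    -- Blocks are relative to c, so one choice of d acts in all (w + 1)-cells of columns at once.
    InBlock : Fin n → Fin k → Fin n → Set
    InBlock c j c' = cell (suc w) c' ≡ cell (suc w) c × digit w c' ≡ d j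

    inBlock? : ∀ c j c' → Dec (InBlock c j c')
    inBlock? c j c' = (cell (suc w) c' ≟ cell (suc w) c) ×-dec (digit w c' Finₚ.≟ d j)

    MeetsAll : Entries → Fin n → Fin n → Set
    MeetsAll B r c = ∀ j → ∃[ c' ] B r c' ≡ true × InBlock c j c'

    meetsAll? : ∀ B r c → Dec (MeetsAll B r c)
    meetsAll? B r c = all? λ j → any? λ c' → (B r c' Bool.≟ true) ×-dec inBlock? c j c'

    fullRows : Entries → Entries
    fullRows B r c = B r c ∧ does (meetsAll? B r c)

    -- The inner filter runs on both sides of `sep`: after it, to embed one half of `P` in entries
    -- that continue up and down; before it, so that the continuations themselves extend to the
    -- other half. Scale 0 is supplied at `[]`, so a vector of length `i` serves class `suc i`.
    filter : ℕ → ∀ {i} → Vec ℕ i → Entries → Entries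
    filter hi []       B = fullRows (sep 0 hi (fullRows B))
    filter hi (lo ∷ v) B = filter lo v (sep lo hi (filter lo v B))

    -- Only deletions made by `sep` are recorded. Those made by `fullRows` need no record, as `k`
    -- entries of one row in the `k` sub-blocks keep each other alive.
    killed : ℕ → ∀ {i} → Vec ℕ i → Entries → Entries
    killed hi []       B r c = removed 0 hi (fullRows B) r c
    killed hi (lo ∷ v) B r c = killed lo v B r c ∨
      (removed lo hi (filter lo v B) r c ∨ killed lo v (sep lo hi (filter lo v B)) r c)

    module _ {r : Fin n} (cs : Fin k → Fin n)
             (same : ∀ i j → cell (suc w) (cs i) ≡ cell (suc w) (cs j))
             (digits : ∀ j → digit w (cs j) ≡ d j) where

      fullRows-keeps : ∀ B → (∀ j → B r (cs j) ≡ true) → ∀ j → fullRows B r (cs j) ≡ true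
      fullRows-keeps B h j = ∧-intro (h j)
        (dec-true (meetsAll? B r (cs j)) λ i → cs i , h i , same i j , digits i)

      -- By induction along the stages: `fullRows` keeps the group because its members witness
      -- `MeetsAll` for one another, and a deletion by `sep` would appear in `killed`.
      filter-keeps : ∀ hi {i} (v : Vec ℕ i) B → (∀ j → B r (cs j) ≡ true) →
        (∀ j → killed hi v B r (cs j) ≡ false) → ∀ j → filter hi v B r (cs j) ≡ true
      filter-keeps hi [] B h kl = fullRows-keeps (sep 0 hi (fullRows B)) λ j →
        sep-keeps 0 hi (fullRows B) (fullRows-keeps B h j) (kl j)
      filter-keeps hi (lo ∷ v) B h kl = filter-keeps lo v (sep lo hi (filter lo v B))
        (λ j → sep-keeps lo hi (filter lo v B) (filter-keeps lo v B h (λ i → ∨-falseˡ (kl i)) j)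
          (∨-falseˡ (∨-falseʳ {killed lo v B r (cs j)} (kl j))))
        (λ j → ∨-falseʳ {removed lo hi (filter lo v B) r (cs j)} (∨-falseʳ {killed lo v B r (cs j)} (kl j)))
        where
        ∨-falseˡ : ∀ {x y} → x ∨ y ≡ false → x ≡ false
        ∨-falseˡ {false} _ = refl
        ∨-falseʳ : ∀ {x y} → x ∨ y ≡ false → y ≡ false
        ∨-falseʳ {false} h = h

    -- Embedding `P` through a surviving entry.

    record Embedding {l} (P : Matrix l k) (B : Entries) (lev : ℕ) (r : Fin n) (y : Fin k) (c : Fin n) : Set where
      field
        row     : Fin l → Fin n
        col     : Fin k → Fin n
        row-inc : StrictlyIncreasing row
        entry   : ∀ i j → P i j ≡ true → B (row i) (col j) ≡ true
        inCell  : ∀ i → cell lev (row i) ≡ cell lev r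
        col-y   : col y ≡ c
        inBlock : ∀ j → InBlock c j (col j)
        -- Demanded even of columns where `P` has no 1-entry: the entry in column `z` is the
        -- starting point for reaching the other half.
        meets   : ∀ j → ∃[ r' ] cell lev r' ≡ cell lev r × B r' (col j) ≡ true
    open Embedding

    record Extends (s lev : ℕ) (G : Entries → Entries) : Set where
      field
        shrinks : ∀ {B} → G B ⊆ B
        extend  : ∀ {l} {P : Matrix l k} → Class s P → ∀ B r y c → digit w c ≡ d y →
                  G B r c ≡ true → Embedding P B lev r y c
    open Extends

    fullRows-extends : Extends 0 0 fullRows
    fullRows-extends .shrinks {B} {r} {c} = ∧-elimˡ {B r c}
    fullRows-extends .extend (single 0 P) B r y c dig h = record
      { row     = λ _ → r
      ; col     = proj₁ ∘ at
      ; row-inc = λ { {fzero} {fzero} () }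
      ; entry   = λ _ j _ → proj₁ (proj₂ (at j))
      ; inCell  = λ _ → refl
      ; col-y   = at-y
      ; inBlock = proj₂ ∘ proj₂ ∘ at
      ; meets   = λ j → r , refl , proj₁ (proj₂ (at j))
      }
      where
      meetsAll : MeetsAll B r c
      meetsAll = does-sound (meetsAll? B r c) (∧-elimʳ {B r c} h)
      at : MeetsAll B r c
      -- Column `y` must be `c` itself, not some other column of the same sub-block.
      at j with j Finₚ.≟ y
      ... | yes refl = c , ∧-elimˡ h , refl , dig
      ... | no _     = meetsAll j
      at-y : proj₁ (at y) ≡ c
      at-y with y Finₚ.≟ y
      ... | yes refl = refl
      ... | no y≢y   = ⊥-elim (y≢y refl)

    weaken : ∀ {l} {P : Matrix l k} {B B' lo hi r r' y c} → B ⊆ B' → lo ≤ hi → cell hi r ≡ cell hi r' →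
      Embedding P B lo r y c → Embedding P B' hi r' y c
    weaken B⊆ lo≤hi e E = record
      { row = row E ; col = col E ; row-inc = row-inc E
      ; entry = λ i j p → B⊆ (entry E i j p)
      ; inCell = λ i → trans (cell-coarsen lo≤hi (inCell E i)) e
      ; col-y = col-y E ; inBlock = inBlock E
      ; meets = λ j → let r' , e' , b = meets E j in r' , trans (cell-coarsen lo≤hi e') e , B⊆ b }

    hasOne? : ∀ {l} (P : Matrix l k) j → Dec (∃[ i ] P i j ≡ true)
    hasOne? P j = any? λ i → P i j Bool.≟ true

    module Glue {a b : ℕ} (P : Matrix (a + b) k) {B lo hi r r₁ r₂ y₁ y₂ c₁ c₂} (z : Fin k)
             (z-only : ∀ j → Straddles {a} {b} P j → j ≡ z)
             (E₁ : Embedding (topRows {a} {b} P) B lo r₁ y₁ c₁)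
             (E₂ : Embedding (bottomRows {a} {b} P) B lo r₂ y₂ c₂)
             (lo≤hi : lo ≤ hi) (r₁<r₂ : cell lo r₁ ℕ.< cell lo r₂)
             (h₁ : cell hi r₁ ≡ cell hi r) (h₂ : cell hi r₂ ≡ cell hi r)
             (agree : col E₁ z ≡ col E₂ z)
             where

      merged-row : Fin a ⊎ Fin b → Fin n
      merged-row (inj₁ i) = row E₁ i
      merged-row (inj₂ i) = row E₂ i

      merged-col : Fin k → Fin n
      merged-col j with hasOne? (topRows {a} {b} P) j
      ... | yes _ = col E₁ j
      ... | no  _ = col E₂ j

      merged-top : ∀ j → (∃[ i ] topRows {a} {b} P i j ≡ true) → merged-col j ≡ col E₁ j
      merged-top j t with hasOne? (topRows {a} {b} P) j
      ... | yes _ = refl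
      ... | no ¬t = ⊥-elim (¬t t)

      merged-bottom : ∀ j → ¬ (∃[ i ] topRows {a} {b} P i j ≡ true) → merged-col j ≡ col E₂ j
      merged-bottom j ¬t with hasOne? (topRows {a} {b} P) j
      ... | yes t = ⊥-elim (¬t t)
      ... | no _  = refl

      row-inc′ : ∀ x x' → join a b x <ᶠ join a b x' → merged-row x <ᶠ merged-row x'
      row-inc′ (inj₁ i) (inj₁ i') h = row-inc E₁ (subst₂ ℕ._<_ (toℕ-↑ˡ i b) (toℕ-↑ˡ i' b) h)
      row-inc′ (inj₂ i) (inj₂ i') h = row-inc E₂ (+-cancelˡ-< a _ _ (subst₂ ℕ._<_ (toℕ-↑ʳ a i) (toℕ-↑ʳ a i') h))
      -- The halves occupy different `lo`-cells, so every top row precedes every bottom row.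
      row-inc′ (inj₁ i) (inj₂ i') h = cell-<⇒< lo (subst₂ ℕ._<_ (sym (inCell E₁ i)) (sym (inCell E₂ i')) r₁<r₂)
      row-inc′ (inj₂ i) (inj₁ i') h = ⊥-elim (<⇒≱ h (≤-trans (≤-reflexive (toℕ-↑ˡ i' b))
        (≤-trans (<⇒≤ (toℕ<n i')) (≤-trans (m≤m+n a _) (≤-reflexive (sym (toℕ-↑ʳ a i)))))))

      -- A 1-entry of the bottom half in a column owned by the top half makes that column straddle,
      -- so it is `z`, where the two embeddings use the same column.
      entry′ : ∀ x j → P (join a b x) j ≡ true → B (merged-row x) (merged-col j) ≡ true
      entry′ (inj₁ i) j p with hasOne? (topRows {a} {b} P) j
      ... | yes _ = entry E₁ i j p
      ... | no ¬t = ⊥-elim (¬t (i , p))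
      entry′ (inj₂ i) j p with hasOne? (topRows {a} {b} P) j
      ... | no _  = entry E₂ i j p
      ... | yes t with z-only j (t , i , p)
      ...   | refl = subst (λ c → B (row E₂ i) c ≡ true) (sym agree) (entry E₂ i j p)

      inCell′ : ∀ x → cell hi (merged-row x) ≡ cell hi r
      inCell′ (inj₁ i) = trans (cell-coarsen lo≤hi (inCell E₁ i)) h₁
      inCell′ (inj₂ i) = trans (cell-coarsen lo≤hi (inCell E₂ i)) h₂

      join-split : ∀ i → join a b (splitAt a i) ≡ i
      join-split = join-splitAt a b

      glue : ∀ {y c} → merged-col y ≡ c → cell (suc w) c₁ ≡ cell (suc w) c → cell (suc w) c₂ ≡ cell (suc w) c →
        Embedding P B hi r y c
      glue {c = c} col≡ e₁ e₂ = record
        { row     = merged-row ∘ splitAt a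
        ; col     = merged-col
        ; row-inc = λ {i} {j} i<j → row-inc′ (splitAt a i) (splitAt a j)
            (subst₂ _<ᶠ_ (sym (join-split i)) (sym (join-split j)) i<j)
        ; entry   = λ i j p → entry′ (splitAt a i) j (subst (λ x → P x j ≡ true) (sym (join-split i)) p)
        ; inCell  = inCell′ ∘ splitAt a
        ; col-y   = col≡
        ; inBlock = inBlock′
        ; meets   = meets′
        }
        where
        inBlock′ : ∀ j → InBlock c j (merged-col j)
        inBlock′ j with hasOne? (topRows {a} {b} P) j
        ... | yes _ = trans (proj₁ (inBlock E₁ j)) e₁ , proj₂ (inBlock E₁ j)
        ... | no  _ = trans (proj₁ (inBlock E₂ j)) e₂ , proj₂ (inBlock E₂ j)
        meets′ : ∀ j → ∃[ r' ] cell hi r' ≡ cell hi r × B r' (merged-col j) ≡ true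
        meets′ j with hasOne? (topRows {a} {b} P) j
        ... | yes _ = let r' , e , x = meets E₁ j in r' , trans (cell-coarsen lo≤hi e) h₁ , x
        ... | no  _ = let r' , e , x = meets E₂ j in r' , trans (cell-coarsen lo≤hi e) h₂ , x

    straddling : ∀ {a b} (P : Matrix (a + b) k) → VSep a b P → Fin k →
      ∃[ z ] ∀ j → Straddles {a} {b} P j → j ≡ z
    straddling {a} {b} P vs y
      with any? (λ j → hasOne? (topRows {a} {b} P) j ×-dec hasOne? (bottomRows {a} {b} P) j)
    ... | yes (z , st) = z , λ j st' → vs j z st' st
    -- Without a straddling column, `y` serves as a default along which the halves are joined all
    -- the same.
    ... | no ¬st       = y , λ j st → ⊥-elim (¬st (j , st))

    -- The half of P owning column y is embedded first, inside sep; the entry it has in the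
    -- straddling column z then leads to another lo-cell, where the other half is embedded.
    double-extends : ∀ {s lo G} hi → Extends s lo G → Extends (suc s) hi (G ∘ sep lo hi ∘ G)
    double-extends {lo = lo} {G} hi Ex .shrinks {B} h = shrinks Ex {B} (sep-⊆ {lo} {hi} {G B} (shrinks Ex {sep lo hi (G B)} h))
    double-extends {s} {lo} {G} hi Ex .extend cl B r y c dig h
      = go cl
      where
      X : Entries
      X = sep lo hi (G B)
      X⊆B : X ⊆ B
      X⊆B {r} {c} x = shrinks Ex (sep-⊆ {lo} {hi} {G B} {r} {c} x)
      -- Not a condition on colours: the surviving entry has a continuation in its `hi`-cell but
      -- outside its `lo`-cell.
      lo≤hi : lo ≤ hi
      lo≤hi with sep-below {lo} {hi} {G B} (shrinks Ex {X} h)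
      ... | _ , _ , e , lt = cell-separates lt e
      go : ∀ {l} {P : Matrix l k} → Class (suc s) P → Embedding P B hi r y c
      go (single _ P) = weaken X⊆B lo≤hi refl (extend Ex (single s P) X r y c dig h)
      go (split _ {a} {b} P _ _ vs top bot)
        with straddling P vs y | hasOne? (topRows {a} {b} P) y
      ... | z , only | yes own
        with extend Ex top X r y c dig h
      ... | E₁ with meets E₁ z
      ... | r₁ , e₁ , x₁ with sep-below {lo} {hi} {G B} x₁
      ... | r₂ , x₂ , e₂ , lt
        with extend Ex bot B r₂ z (col E₁ z) (proj₂ (inBlock E₁ z)) x₂
      ... | E₂ = glue (trans (merged-top y own) (col-y E₁)) refl (proj₁ (inBlock E₁ z))
        where
        open Glue P z only (weaken X⊆B ≤-refl refl E₁) E₂ lo≤hi (subst (ℕ._< cell lo r₂) e₁ lt)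
          refl (trans e₂ (cell-coarsen lo≤hi e₁)) (sym (col-y E₂))
      go (split _ {a} {b} P _ _ vs top bot) | z , only | no foreign
        with extend Ex bot X r y c dig h
      ... | E₂ with meets E₂ z
      ... | r₂ , e₂ , x₂ with sep-above {lo} {hi} {G B} x₂
      ... | r₁ , x₁ , e₁ , lt
        with extend Ex top B r₁ z (col E₂ z) (proj₂ (inBlock E₂ z)) x₁
      ... | E₁ = glue (trans (merged-bottom y foreign) (col-y E₂)) (proj₁ (inBlock E₂ z)) refl
        where
        open Glue P z only E₁ (weaken X⊆B ≤-refl refl E₂) lo≤hi (subst (cell lo r₁ ℕ.<_) e₂ lt)
          (trans e₁ (cell-coarsen lo≤hi e₂)) refl (col-y E₁)

    filter-extends : ∀ hi {i} (v : Vec ℕ i) → Extends (suc i) hi (filter hi v)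
    filter-extends hi []       = double-extends hi fullRows-extends
    filter-extends hi (lo ∷ v) = double-extends hi (filter-extends lo v)

    -- All embedded columns lie in the `suc w`-cell of `c`, with digits prescribed by `d`; hence
    -- increasing `d` puts them in order.
    filter-contains : ∀ {i l hi A r c y} {P : Matrix l k} (v : Vec ℕ i) → Class (suc i) P →
      StrictlyIncreasing d → digit w c ≡ d y → filter hi v A r c ≡ true → Contains A P
    filter-contains {hi = hi} {A} {r} {c} {y} v cl inc dig h =
      row E , col E , row-inc E , col-inc , entry E
      where
      E = extend (filter-extends hi v) cl A r y c dig h
      col-inc : StrictlyIncreasing (col E)
      col-inc {i} {j} i<j = digit-< w (trans (proj₁ (inBlock E i)) (sym (proj₁ (inBlock E j))))
        (subst₂ _<ᶠ_ (sym (proj₂ (inBlock E i))) (sym (proj₂ (inBlock E j))) (inc i<j))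

-- Counting, in one column, the entries deleted for every colour.

descend : ∀ {N} (Q : Fin N → Set) → (∀ J → Dec (Q J)) → ∀ J → Q J →
  ∃[ J' ] Q J' × (∀ j → toℕ J' ≡ suc (toℕ j) → ¬ Q j)
descend {N} Q Q? J = go (toℕ J) J refl
  where
  go : ∀ m J → toℕ J ≡ m → Q J → ∃[ J' ] Q J' × (∀ j → toℕ J' ≡ suc (toℕ j) → ¬ Q j)
  -- Index zero has no predecessor, so the last condition is vacuous.
  go zero    J e q = J , q , λ j e' _ → 0≢1+n (trans (sym e) e')
  go (suc m) J e q with Q? (fromℕ< {m} (<-trans (n<1+n m) (subst (ℕ._< N) e (toℕ<n J))))
  ... | yes q' = go m _ (toℕ-fromℕ< _) q'
  ... | no ¬q  = J , q , λ j e' qj → ¬q (subst Q (toℕ-injective (sym (trans (toℕ-fromℕ< _) (suc-injective (trans (sym e) e'))))) qj)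

-- Exponent of `H` in the count below, where `H` dominates 2, `M` and `S + 1`, and `H ^ a` bounds
-- the number of filter runs. The summand `3 + i + a` pays for the scale, the digit, the direction,
-- the remaining `i` scales of the colour and the run; `suc a` reflects the doubling of runs.
growth : ℕ → ℕ → ℕ
growth zero    a = suc a
growth (suc i) a = (3 + i + a) + growth i (suc a)

module Scales (n M S k : ℕ) .{{_ : NonZero M}} where
  open Grid n M

  Shape : Set
  Shape = ℕ × (Fin k → Fin M)

  kill filt : Shape → ℕ → ∀ {i} → Vec ℕ i → Entries → Entries
  kill (w , d) = Blocks.killed w d
  filt (w , d) = Blocks.filter w d

  decode : ∀ i → Fin (suc S ^ i) → Vec ℕ i
  decode zero    _ = []
  decode (suc i) x = toℕ (proj₁ (remQuot {suc S} (suc S ^ i) x)) ∷ decode i (proj₂ (remQuot {suc S} (suc S ^ i) x))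

  decode-combine : ∀ i (J : Fin (suc S)) x → decode (suc i) (combine J x) ≡ toℕ J ∷ decode i x
  decode-combine i J x = cong (λ (J , x) → toℕ J ∷ decode i x) (remQuot-combine J x)

  module _ (H : ℕ) .{{_ : NonZero H}} (2≤H : 2 ≤ H) (M≤H : M ≤ H) (S<H : S ℕ.< H) (c : Fin n) where

    private
      double : ∀ {N a} → N ≤ H ^ a → N + N ≤ H ^ suc a
      double {N} {a} h = ≤-trans (≤-reflexive (cong (N +_) (sym (+-identityʳ N)))) (*-mono-≤ 2≤H h)

      1≤H^ : ∀ a → 1 ≤ H ^ a
      1≤H^ a = m^n>0 H a

    -- Generalised for the induction on `i`: each colour `x` has its own `N` runs, with their shapes
    -- and starting sets, because every level replaces one run by two inner runs. For `i = 0` a run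
    -- and a direction determine the row, as scale 0 separates rows.
    killed-everywhere-bound : ∀ i a hi N → hi ≤ S → N ≤ H ^ a →
      (fam : Fin (suc S ^ i) → Fin N → Shape × Entries) (p : Fin n → Bool) →
      (∀ r r' → p r ≡ true → p r' ≡ true → cell hi r ≡ cell hi r') →
      (∀ r → p r ≡ true → ∀ x → ∃[ e ] kill (proj₁ (fam x e)) hi (decode i x) (proj₂ (fam x e)) r c ≡ true) →
      countRow p ≤ H ^ growth i a
    killed-everywhere-bound zero a hi N _ N≤ fam p same kl = ≤-trans
      (union-bound N (λ e r → removed 0 hi (X e) r c ≡ true) (2 * 1) p (λ r pr → kl r pr fzero)
        λ e q hq → union-bound 2 (λ δ r → Extreme 0 hi (X e) δ r c) 1 q
          (λ r qr → removed⇒extreme 0 hi (X e) (proj₂ (hq r qr)))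
          λ δ q' hq' → count-subsingleton q' λ r r' qr qr' → toℕ-injective
            (extreme-cell {0} {hi} {X e} δ (proj₂ (hq' r qr)) (proj₂ (hq' r' qr'))
              (same r r' (proj₁ (hq r (proj₁ (hq' r qr)))) (proj₁ (hq r' (proj₁ (hq' r' qr')))))))
      (≤-trans (≤-reflexive (*-comm N 2)) (*-mono-≤ 2≤H N≤))
      where
      X : Fin N → Entries
      X e = Blocks.fullRows (proj₁ (proj₁ (fam fzero e))) (proj₂ (proj₁ (fam fzero e))) (proj₂ (fam fzero e))
    killed-everywhere-bound (suc i) a hi N hi≤S N≤ fam p same kl = ≤-trans
      (union-bound (suc S) R (H ^ (1 + i + a) * (M * rest)) p total level-bound)
      (≤-trans (*-mono-≤ S<H (*-monoʳ-≤ (H ^ (1 + i + a)) (*-monoˡ-≤ rest M≤H))) (≤-reflexive power))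
      where
      rest : ℕ
      rest = H ^ growth i (suc a)
      power : H * (H ^ (1 + i + a) * (H * rest)) ≡ H ^ growth (suc i) a
      power = begin
        H * (H ^ (1 + i + a) * (H * rest)) ≡⟨ cong (H *_) (*-x∙yz≈y∙xz (H ^ (1 + i + a)) H rest) ⟩
        H * (H * (H ^ (1 + i + a) * rest)) ≡⟨ cong (λ x → H * (H * x)) (sym (^-distribˡ-+-* H (1 + i + a) (growth i (suc a)))) ⟩
        H ^ growth (suc i) a ∎
        where open ≡-Reasoning
      shape : Fin (suc S) → Fin (suc S ^ i) → Fin N → Shape
      shape J x e = proj₁ (fam (combine J x) e)
      start X : Fin (suc S) → Fin (suc S ^ i) → Fin N → Entries
      start J x e = proj₂ (fam (combine J x) e)
      X J x e = filt (shape J x e) (toℕ J) (decode i x) (start J x e)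
      Reached : Fin n → Fin (suc S) → Set
      Reached r J = toℕ J ≡ hi ⊎ ∃[ x ] ∃[ e ] removed (toℕ J) hi (X J x e) r c ≡ true
      reached? : ∀ r J → Dec (Reached r J)
      reached? r J = (toℕ J ≟ hi) ⊎-dec any? λ x → any? λ e → removed (toℕ J) hi (X J x e) r c Bool.≟ true
      -- Scales are walked down from hi, and J is the last one before the first at which no colour
      -- removes r in this step. The hi-cell of r determines its J-cell up to few choices, and
      -- for colours whose next scale is the one below J, r dies at an inner step.
      R : Fin (suc S) → Fin n → Set
      R J r = Reached r J × (∀ j → toℕ J ≡ suc (toℕ j) → ¬ Reached r j)
      total : ∀ r → p r ≡ true → ∃[ J ] R J r
      total r _ = descend (Reached r) (reached? r) (fromℕ< (s≤s hi≤S)) (inj₁ (toℕ-fromℕ< (s≤s hi≤S)))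

      -- The inner filter runs on two entry sets, hence the doubled index.
      next : (j : Fin (suc S)) → Fin (suc S ^ i) → Fin (N + N) → Shape × Entries
      next j x e with splitAt N e
      ... | inj₁ e = fam (combine j x) e
      ... | inj₂ e = shape j x e , sep (toℕ j) hi (X j x e)

      -- For a colour starting with `j`, an entry dies in the first inner run, at the separation, or
      -- in the second inner run; the middle case would make `j` reached.
      still-killed : ∀ r → p r ≡ true → (j : Fin (suc S)) → ¬ Reached r j → ∀ x →
        ∃[ e ] kill (proj₁ (next j x e)) (toℕ j) (decode i x) (proj₂ (next j x e)) r c ≡ true
      still-killed r pr j ¬r x with kl r pr (combine j x)
      ... | e , h
        with ∨-elim {kill (shape j x e) (toℕ j) (decode i x) (start j x e) r c}
               (subst (λ v → kill (shape j x e) hi v (start j x e) r c ≡ true) (decode-combine i j x) h)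
      ... | inj₁ h₁ = e ↑ˡ N , first
        where
        first : kill (proj₁ (next j x (e ↑ˡ N))) (toℕ j) (decode i x) (proj₂ (next j x (e ↑ˡ N))) r c ≡ true
        first rewrite splitAt-↑ˡ N e N = h₁
      ... | inj₂ h₂ with ∨-elim {removed (toℕ j) hi (X j x e) r c} h₂
      ... | inj₁ rem = ⊥-elim (¬r (inj₂ (x , e , rem)))
      ... | inj₂ h₃ = N ↑ʳ e , second
        where
        second : kill (proj₁ (next j x (N ↑ʳ e))) (toℕ j) (decode i x) (proj₂ (next j x (N ↑ʳ e))) r c ≡ true
        second rewrite splitAt-↑ʳ N N e = h₃

      -- At scale 0 the cell is a row. Otherwise a choice of digit fixes the cell one scale finer;
      -- that scale is not reached, so the induction applies there with `N + N` runs.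
      cell-bound : ∀ J (q : Fin n → Bool) → (∀ r → q r ≡ true → p r ≡ true × R J r) →
        (∀ r r' → q r ≡ true → q r' ≡ true → cell (toℕ J) r ≡ cell (toℕ J) r') → countRow q ≤ M * rest
      cell-bound fzero q hq eq = ≤-trans
        (count-subsingleton q λ r r' qr qr' → toℕ-injective (eq r r' qr qr'))
        (*-mono-≤ (ℕ.>-nonZero⁻¹ M) (1≤H^ (growth i (suc a))))
      cell-bound (fsuc j) q hq eq = union-bound M (λ μ r → digit (toℕ j) r ≡ μ) rest q (λ r _ → _ , refl)
        λ μ q' hq' → killed-everywhere-bound i (suc a) (toℕ (inject₁ j)) (N + N)
          (≤-pred (toℕ<n (inject₁ j))) (double {N} {a} N≤) (next (inject₁ j)) q'
          (λ r r' qr qr' → subst (λ l → cell l r ≡ cell l r') (sym (toℕ-inject₁ j))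
            (cell-refine (toℕ j) (eq r r' (proj₁ (hq' r qr)) (proj₁ (hq' r' qr')))
              (trans (proj₂ (hq' r qr)) (sym (proj₂ (hq' r' qr'))))))
          λ r qr → let pr , _ , stuck = hq r (proj₁ (hq' r qr)) in
            still-killed r pr (inject₁ j) (stuck (inject₁ j) (cong suc (sym (toℕ-inject₁ j))))

      -- If `J` is `hi`, the `J`-cell is already fixed. Otherwise a removal reached `J`, and the
      -- rest of the colour, the run and the direction determine the cell by `extreme-cell`.
      level-bound : ∀ J (q : Fin n → Bool) → (∀ r → q r ≡ true → p r ≡ true × R J r) →
        countRow q ≤ H ^ (1 + i + a) * (M * rest)
      level-bound J q hq with toℕ J ≟ hi
      ... | yes J≡hi = ≤-trans
        (cell-bound J q hq λ r r' qr qr' → subst (λ l → cell l r ≡ cell l r') (sym J≡hi)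
          (same r r' (proj₁ (hq r qr)) (proj₁ (hq r' qr'))))
        (≤-trans (≤-reflexive (sym (*-identityˡ _))) (*-monoˡ-≤ (M * rest) (1≤H^ (1 + i + a))))
      ... | no J≢hi = ≤-trans
        (union-bound (suc S ^ i) (λ x r → ∃[ e ] removed (toℕ J) hi (X J x e) r c ≡ true) (N * (2 * (M * rest))) q
          (λ r qr → someEvent r (proj₁ (proj₂ (hq r qr))))
          λ x q₁ h₁ → union-bound N (λ e r → removed (toℕ J) hi (X J x e) r c ≡ true) (2 * (M * rest)) q₁
            (λ r q₁r → proj₂ (h₁ r q₁r))
            λ e q₂ h₂ → union-bound 2 (λ δ r → Extreme (toℕ J) hi (X J x e) δ r c) (M * rest) q₂
              (λ r q₂r → removed⇒extreme (toℕ J) hi (X J x e) (proj₂ (h₂ r q₂r)))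
              λ δ q₃ h₃ →
                let up : ∀ r → q₃ r ≡ true → p r ≡ true × R J r
                    up = λ r q₃r → hq r (proj₁ (h₁ r (proj₁ (h₂ r (proj₁ (h₃ r q₃r))))))
                in cell-bound J q₃ up λ r r' qr qr' →
                  extreme-cell {toℕ J} {hi} {X J x e} δ (proj₂ (h₃ r qr)) (proj₂ (h₃ r' qr'))
                    (same r r' (proj₁ (up r qr)) (proj₁ (up r' qr'))))
        (≤-trans (*-mono-≤ (^-monoˡ-≤ i S<H) (*-mono-≤ N≤ (*-monoˡ-≤ (M * rest) 2≤H))) (≤-reflexive collect))
        where
        someEvent : ∀ r → Reached r J → ∃[ x ] ∃[ e ] removed (toℕ J) hi (X J x e) r c ≡ true
        someEvent r (inj₁ J≡hi) = ⊥-elim (J≢hi J≡hi)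
        someEvent r (inj₂ ev)   = ev
        collect : H ^ i * (H ^ a * (H * (M * rest))) ≡ H ^ (1 + i + a) * (M * rest)
        collect = begin
          H ^ i * (H ^ a * (H * (M * rest))) ≡⟨ sym (*-assoc (H ^ i) (H ^ a) _) ⟩
          (H ^ i * H ^ a) * (H * (M * rest)) ≡⟨ cong (_* (H * (M * rest))) (sym (^-distribˡ-+-* H i a)) ⟩
          H ^ (i + a) * (H * (M * rest))     ≡⟨ sym (*-assoc (H ^ (i + a)) H _) ⟩
          (H ^ (i + a) * H) * (M * rest)     ≡⟨ cong (_* (M * rest)) (*-comm (H ^ (i + a)) H) ⟩
          H ^ (1 + i + a) * (M * rest)       ∎
          where open ≡-Reasoning

  -- Good entries along a row, and the combined count.

  shape-at : Fin (S * M ^ k) → Shape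
  shape-at e = toℕ (proj₁ (remQuot {S} (M ^ k) e)) , finToFun (proj₂ (remQuot {S} (M ^ k) e))

  shape-at-combine : ∀ w δ → shape-at (combine w δ) ≡ (toℕ w , finToFun δ)
  shape-at-combine w δ = cong (λ (w , δ) → toℕ w , finToFun δ) (remQuot-combine w δ)

  module _ {s l} {P : Matrix l k} (class : Class (suc s) P) (y : Fin k)
           (A : Entries) (avoids : Avoids A P) (n≤M^S : n ≤ M ^ S) where

    colours : ℕ
    colours = suc S ^ s

    Free : Fin n → Fin colours → Fin n → Set
    Free r x c = A r c ≡ true × ∀ e → kill (shape-at e) S (decode s x) A r c ≡ false

    free-at : ∀ {r x c w} → w ℕ.< S → (δ : Fin (M ^ k)) → Free r x c →
      kill (w , finToFun δ) S (decode s x) A r c ≡ false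
    free-at {r} {x} {c} {w} w<S δ (_ , free) =
      subst (λ w → kill (w , finToFun δ) S (decode s x) A r c ≡ false) (toℕ-fromℕ< w<S)
        (subst (λ sh → kill sh S (decode s x) A r c ≡ false) (shape-at-combine (fromℕ< w<S) δ)
          (free (combine (fromℕ< w<S) δ)))

    -- k free entries of one colour in distinct sub-blocks of one block all survive the filter,
    -- so they would give a copy of P.
    no-free-group : ∀ {r x w} → w ℕ.< S → (cs : Fin k → Fin n) → (∀ j → Free r x (cs j)) →
      (∀ i j → cell (suc w) (cs i) ≡ cell (suc w) (cs j)) →
      StrictlyIncreasing (digit w ∘ cs) → ⊥
    no-free-group {r} {x} {w} w<S cs free same inc = avoids
      -- One survivor of the filter suffices; the one in column `y` is taken.
      (filter-contains {hi = S} {A} {r} {cs y} {y} (decode s x) class inc′ (digits y)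
        (filter-keeps cs same digits S (decode s x) A (proj₁ ∘ free) (free-at w<S δ ∘ free) y))
      where
      δ : Fin (M ^ k)
      δ = funToFin (digit w ∘ cs)
      open Blocks {k} w (finToFun {M} {k} δ)
      digits : ∀ j → digit w (cs j) ≡ finToFun {M} {k} δ j
      digits j = sym (finToFun-funToFin (digit w ∘ cs) j)
      inc′ : StrictlyIncreasing (finToFun {M} {k} δ)
      inc′ {i} {j} i<j = subst₂ _<ᶠ_ (digits i) (digits j) (inc i<j)

    -- Within a `suc J`-cell, entries free for one colour occupy at most `k` sub-cells by
    -- `no-free-group`. The colour is chosen anew at each scale, whence a factor `colours * k` per
    -- scale.
    free-bound : ∀ r J → J ≤ S → (p : Fin n → Bool) →
      (∀ c c' → p c ≡ true → p c' ≡ true → cell J c ≡ cell J c') →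
      (∀ c → p c ≡ true → ∃[ x ] Free r x c) → countRow p ≤ (colours * k) ^ J
    free-bound r zero    _   p same free =
      count-subsingleton p λ c c' pc pc' → toℕ-injective (same c c' pc pc')
    free-bound r (suc J) J<S p same free = ≤-trans
      (union-bound colours (Free r) (k * (colours * k) ^ J) p free λ x q hq →
        let D : Fin M → Bool
            D μ = does (occurs? q μ)
        in ≤-trans
          (fibre-bound M D (λ μ c → digit J c ≡ μ) ((colours * k) ^ J) q
            (λ c qc → digit J c , dec-true (occurs? q _) (c , qc , refl) , refl)
            λ μ q' hq' → free-bound r J (<⇒≤ J<S) q'
              (λ c c' qc qc' → cell-refine J
                (same c c' (proj₁ (hq c (proj₁ (hq' c qc)))) (proj₁ (hq c' (proj₁ (hq' c' qc')))))
                (trans (proj₂ (hq' c qc)) (sym (proj₂ (hq' c' qc')))))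
              (λ c qc → x , proj₂ (hq c (proj₁ (hq' c qc)))))
          (*-monoˡ-≤ ((colours * k) ^ J) (few-digits x q hq)))
      (≤-reflexive (sym (*-assoc colours k _)))
      where
      occurs? : ∀ (q : Fin n → Bool) μ → Dec (∃[ c ] q c ≡ true × digit J c ≡ μ)
      occurs? q μ = any? λ c → (q c Bool.≟ true) ×-dec (digit J c Finₚ.≟ μ)
      few-digits : ∀ x (q : Fin n → Bool) → (∀ c → q c ≡ true → p c ≡ true × Free r x c) →
        countRow (λ μ → does (occurs? q μ)) ≤ k
      few-digits x q hq = ≮⇒≥ λ k<count →
        let d , inc , occ = increasing-choice k (λ μ → does (occurs? q μ)) (<⇒≤ k<count)
            at : ∀ j → ∃[ c ] q c ≡ true × digit J c ≡ d j
            at j = does-sound (occurs? q (d j)) (occ j)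
            ok : ∀ j → p (proj₁ (at j)) ≡ true × Free r x (proj₁ (at j))
            ok j = hq (proj₁ (at j)) (proj₁ (proj₂ (at j)))
        in no-free-group J<S (proj₁ ∘ at) (proj₂ ∘ ok)
             (λ i j → same _ _ (proj₁ (ok i)) (proj₁ (ok j)))
             (λ {i} {j} i<j → subst₂ _<ᶠ_ (sym (proj₂ (proj₂ (at i)))) (sym (proj₂ (proj₂ (at j)))) (inc i<j))

    killed-by? : ∀ r c x → Dec (∃[ e ] kill (shape-at e) S (decode s x) A r c ≡ true)
    killed-by? r c x = any? λ e → kill (shape-at e) S (decode s x) A r c Bool.≟ true

    bad? : ∀ r c → Dec (∀ x → ∃[ e ] kill (shape-at e) S (decode s x) A r c ≡ true)
    bad? r c = all? (killed-by? r c)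

    bad good : Entries
    bad  r c = does (bad? r c)
    good r c = A r c ∧ not (bad r c)

    same-top : ∀ r r' → cell S r ≡ cell S r'
    same-top r r' = trans (cell-top S n≤M^S r) (sym (cell-top S n≤M^S r'))

    good-row : ∀ r → countRow (good r) ≤ (colours * k) ^ S
    good-row r = free-bound r S ≤-refl (good r) (λ c c' _ _ → same-top c c') λ c gc →
      let x , ¬k = ¬∀⟶∃¬ colours _ (killed-by? r c) (not-bad c (∧-elimʳ {A r c} gc))
      in x , ∧-elimˡ gc , λ e → Bool.¬-not λ h → ¬k (e , h)
      where
      not-bad : ∀ c → not (bad r c) ≡ true → ¬ (∀ x → ∃[ e ] kill (shape-at e) S (decode s x) A r c ≡ true)
      not-bad c h b = false≢true (trans (cong not (sym (dec-true (bad? r c) b))) h)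

    bad-column : ∀ H .{{_ : NonZero H}} → 2 ≤ H → M ≤ H → S ℕ.< H →
      ∀ c → countRow (λ r → bad r c) ≤ H ^ growth s (suc k)
    -- One run for each of the `S * M ^ k` shapes, at most `H ^ suc k` in all, which gives the
    -- second argument of `growth`.
    bad-column H 2≤H M≤H S<H c = killed-everywhere-bound H 2≤H M≤H S<H c s (suc k) S (S * M ^ k) ≤-refl
      (*-mono-≤ (<⇒≤ S<H) (^-monoˡ-≤ k M≤H)) (λ _ e → shape-at e , A) (λ r → bad r c)
      (λ r r' _ _ → same-top r r') (λ r → does-sound (bad? r c))

    -- Bad entries are few in each column and good entries few in each row, so the bad part is
    -- transposed before summing.
    ones-bound : ∀ H .{{_ : NonZero H}} → 2 ≤ H → M ≤ H → S ℕ.< H →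
      ones A ≤ n * (H ^ growth s (suc k) + (colours * k) ^ S)
    ones-bound H 2≤H M≤H S<H = begin
      ones A                                                ≤⟨ ones-split A bad good cover ⟩
      ones bad + ones good                                  ≡⟨ cong (_+ ones good) (ones-transpose bad) ⟩
      ones (λ c r → bad r c) + ones good
        ≤⟨ +-mono-≤ (ones-rows _ (λ c r → bad r c) (bad-column H 2≤H M≤H S<H)) (ones-rows _ good good-row) ⟩
      n * H ^ growth s (suc k) + n * (colours * k) ^ S      ≡⟨ *-distribˡ-+ n _ _ ⟨
      n * (H ^ growth s (suc k) + (colours * k) ^ S)        ∎
      where
      open ≤-Reasoning
      cover : ∀ r c → A r c ≡ true → bad r c ≡ true ⊎ good r c ≡ true
      cover r c a with bad r c
      ... | true  = inj₁ refl
      ... | false = inj₂ (∧-intro a refl)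

-- Arithmetic for the choice of `S` and `M`.

n≤2^⌈log₂n⌉ : ∀ n → n ≤ 2 ^ ⌈log₂ n ⌉
n≤2^⌈log₂n⌉ = <-rec _ bound
  where
  n≤2⌈n/2⌉ : ∀ n → n ≤ 2 * ⌈ n /2⌉
  n≤2⌈n/2⌉ n = ≤-trans (≤-reflexive (sym (⌊n/2⌋+⌈n/2⌉≡n n)))
    (+-mono-≤ (⌊n/2⌋≤⌈n/2⌉ n) (≤-reflexive (sym (+-identityʳ _))))
  bound : ∀ n → (∀ {m} → m ℕ.< n → m ≤ 2 ^ ⌈log₂ m ⌉) → n ≤ 2 ^ ⌈log₂ n ⌉
  bound zero          _   = z≤n
  bound (suc zero)    _   = s≤s z≤n
  bound n@(suc (suc m)) rec = begin
    n                             ≤⟨ n≤2⌈n/2⌉ n ⟩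
    2 * ⌈ n /2⌉                   ≤⟨ *-monoʳ-≤ 2 (rec (⌈n/2⌉<n m)) ⟩
    2 * 2 ^ ⌈log₂ ⌈ n /2⌉ ⌉       ≡⟨ cong (λ e → 2 * 2 ^ e) (⌈log₂⌈n/2⌉⌉≡⌈log₂n⌉∸1 n) ⟩
    2 ^ suc (⌈log₂ n ⌉ ∸ 1)       ≡⟨ cong (2 ^_) (m+[n∸m]≡n (⌈log₂⌉-mono-≤ {2} {n} (s≤s (s≤s z≤n)))) ⟩
    2 ^ ⌈log₂ n ⌉                 ∎
    where open ≤-Reasoning

n<2^n : ∀ n → n ℕ.< 2 ^ n
n<2^n zero    = s≤s z≤n
n<2^n (suc n) = ≤-trans (+-mono-≤ (m^n>0 2 n) (n<2^n n)) (≤-reflexive (cong (2 ^ n +_) (sym (+-identityʳ (2 ^ n)))))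

-- Upward search from 0 with fuel `L`, where the inequality certainly holds. The last clause is
-- minimality: `suc S` is the root rounded up, but at least 1.
ceil-root : ∀ s L → ∃[ S ] L ≤ suc S ^ suc s × (∀ R → S ≡ suc R → suc R ^ suc s ℕ.< L)
ceil-root s L = search L 0 (≤-trans (m≤n⇒m≤1+n (m≤m+n L 0)) grow) (λ _ ())
  where
  grow : suc (L + 0) ≤ suc (L + 0) ^ suc s
  grow = ≤-trans (≤-reflexive (sym (*-identityʳ _))) (*-monoʳ-≤ (suc (L + 0)) (m^n>0 (suc (L + 0)) s))
  search : ∀ m S → L ≤ suc (m + S) ^ suc s → (∀ R → S ≡ suc R → suc R ^ suc s ℕ.< L) →
    ∃[ S ] L ≤ suc S ^ suc s × (∀ R → S ≡ suc R → suc R ^ suc s ℕ.< L)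
  search zero    S up low = S , up , low
  search (suc m) S up low with L ≤? suc S ^ suc s
  ... | yes le = S , le , low
  ... | no ¬le = search m (suc S) (subst (λ x → L ≤ suc x ^ suc s) (sym (+-suc m S)) up)
                   λ { R refl → ≰⇒> ¬le }

^-distribʳ-* : ∀ s m n → (m * n) ^ s ≡ m ^ s * n ^ s
^-distribʳ-* zero    m n = refl
^-distribʳ-* (suc s) m n = trans (cong (m * n *_) (^-distribʳ-* s m n)) (*-interchange m n (m ^ s) (n ^ s))

-- The hypothesis says that `t` is at least the power `s / (s + 1)` of `L`. By minimality
-- `S ^ suc s < L` for positive `S`, so `t < S ^ s` would contradict it; passing from `S` to `suc S`
-- costs at most `2 ^ s`, and `suc t` covers `S = 0`.
scale-count : ∀ s L t → L ^ s ≤ t ^ suc s → ∃[ S ] L ≤ suc S ^ suc s × suc S ^ s ≤ 2 ^ s * suc t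
scale-count s L t h with ceil-root s L
... | zero , up , _ = zero , up , ≤-trans (≤-reflexive (^-zeroˡ s)) (*-mono-≤ (m^n>0 2 s) (s≤s (z≤n {t})))
... | suc R , up , low = suc R , up , (begin
    suc (suc R) ^ s        ≤⟨ ^-monoˡ-≤ s (≤-trans (s≤s (s≤s (m≤m+n R _))) (≤-reflexive (cong suc (sym (+-suc R (R + 0)))))) ⟩
    (2 * suc R) ^ s        ≡⟨ ^-distribʳ-* s 2 (suc R) ⟩
    2 ^ s * suc R ^ s      ≤⟨ *-monoʳ-≤ (2 ^ s) (m≤n⇒m≤1+n (≮⇒≥ λ t< → <⇒≱ (too-large t<) h)) ⟩
    2 ^ s * suc t          ∎)
  where
  open ≤-Reasoning
  too-large : t ℕ.< suc R ^ s → t ^ suc s ℕ.< L ^ s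
  too-large t< = <-≤-trans (^-monoˡ-< (suc s) t<) (begin
    (suc R ^ s) ^ suc s    ≡⟨ ^-*-assoc (suc R) s (suc s) ⟩
    suc R ^ (s * suc s)    ≡⟨ cong (suc R ^_) (*-comm s (suc s)) ⟩
    suc R ^ (suc s * s)    ≡⟨ sym (^-*-assoc (suc R) (suc s) s) ⟩
    (suc R ^ suc s) ^ s    ≤⟨ ^-monoˡ-≤ s (<⇒≤ (low R refl)) ⟩
    L ^ s                  ∎)

-- With `T = suc S`, the base is at most `2 ^ (T * s + k)`, so its `T`-th power has exponent at most
-- `T ^ suc s * (s + k)`. The good entries thus cost only a fixed power of `M`.
colour-power : ∀ s k S → (suc (suc S) ^ s * k) ^ suc S ≤ (2 ^ suc S ^ suc s) ^ (s + k)
colour-power s k S = begin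
  (suc (suc S) ^ s * k) ^ suc S         ≤⟨ ^-monoˡ-≤ (suc S) (*-mono-≤ (^-monoˡ-≤ s (n<2^n (suc S))) (<⇒≤ (n<2^n k))) ⟩
  ((2 ^ suc S) ^ s * 2 ^ k) ^ suc S     ≡⟨ cong (λ x → (x * 2 ^ k) ^ suc S) (^-*-assoc 2 (suc S) s) ⟩
  (2 ^ (suc S * s) * 2 ^ k) ^ suc S     ≡⟨ cong (_^ suc S) (sym (^-distribˡ-+-* 2 (suc S * s) k)) ⟩
  (2 ^ (suc S * s + k)) ^ suc S         ≡⟨ ^-*-assoc 2 (suc S * s + k) (suc S) ⟩
  2 ^ ((suc S * s + k) * suc S)         ≤⟨ ^-monoʳ-≤ 2 (*-monoˡ-≤ (suc S) (+-mono-≤ (power s) (m≤n*m k (suc S ^ s) {{m^n≢0 (suc S) s}}))) ⟩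
  2 ^ ((suc S ^ s * s + suc S ^ s * k) * suc S) ≡⟨ cong (λ x → 2 ^ (x * suc S)) (sym (*-distribˡ-+ (suc S ^ s) s k)) ⟩
  2 ^ (suc S ^ s * (s + k) * suc S)     ≡⟨ cong (2 ^_) (*-comm (suc S ^ s * (s + k)) (suc S)) ⟩
  2 ^ (suc S * (suc S ^ s * (s + k)))   ≡⟨ cong (2 ^_) (sym (*-assoc (suc S) (suc S ^ s) (s + k))) ⟩
  2 ^ (suc S ^ suc s * (s + k))         ≡⟨ sym (^-*-assoc 2 (suc S ^ suc s) (s + k)) ⟩
  (2 ^ suc S ^ suc s) ^ (s + k)         ∎
  where
  open ≤-Reasoning
  power : ∀ s → suc S * s ≤ suc S ^ s * s
  power zero      = ≤-reflexive (*-zeroʳ (suc S))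
  power s@(suc r) = *-monoˡ-≤ s (m≤m*n (suc S) (suc S ^ r) {{m^n≢0 (suc S) r}})

-- Single rows and the final choice of parameters.

single-row-bound : ∀ {k n} (P : Matrix 1 k) (A : Matrix n n) → Avoids A P → ones A ≤ n * k
single-row-bound {k} P A avoids = ones-rows k A λ r → ≮⇒≥ λ k< →
  let g , inc , h = increasing-choice k (A r) (<⇒≤ k<)
  in avoids ((λ _ → r) , g , (λ { {fzero} {fzero} () }) , inc , λ _ j _ → h j)

-- The sum of the exponents for bad and good entries bounds each of them; `suc` absorbs the factor 2
-- from adding the two counts.
exponent : ℕ → ℕ → ℕ
exponent s k = suc (growth s (suc k) + (s + k))

theorem2 : ∀ (s : ℕ) {l k} (P : Matrix l k) → Class s P → HasOne P →
    ∃[ C ] ∀ (n t : ℕ) → ⌈log₂ n ⌉ ^ s ≤ t ^ (suc s) → ExAtMost n P (n * 2 ^ (C * suc t))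
theorem2 zero {k = k} .P (single 0 P) _ = k , λ n t _ A avoids →
  ≤-trans (single-row-bound P A avoids) (*-monoʳ-≤ n (≤-trans (<⇒≤ (n<2^n k)) (^-monoʳ-≤ 2 (m≤m*n k (suc t)))))
theorem2 (suc s) {k = k} P class (_ , y , _) = 2 ^ suc s * exponent s k , bound
  where
  bound : ∀ n t → ⌈log₂ n ⌉ ^ suc s ≤ t ^ suc (suc s) → ExAtMost n P (n * 2 ^ (2 ^ suc s * exponent s k * suc t))
  bound n t h A avoids with scale-count (suc s) ⌈log₂ n ⌉ t h
  ... | S , up , small = ≤-trans
    -- The base `H` is `M` itself. The top scale is `suc S`, so that `M ^ suc S`, which is 2 to the
    -- power `suc S ^ suc (suc s)`, reaches `n`.
    (Scales.ones-bound n M (suc S) k class y A avoids fits M 2≤M ≤-refl S<M)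
    (*-monoʳ-≤ n (begin
      M ^ g + (suc (suc S) ^ s * k) ^ suc S  ≤⟨ +-monoʳ-≤ (M ^ g) (colour-power s k S) ⟩
      M ^ g + M ^ b                          ≤⟨ +-mono-≤ (^-monoʳ-≤ M (m≤m+n g b)) (^-monoʳ-≤ M (m≤n+m b g)) ⟩
      M ^ (g + b) + M ^ (g + b)              ≡⟨ cong (M ^ (g + b) +_) (sym (+-identityʳ _)) ⟩
      2 * M ^ (g + b)                        ≤⟨ *-monoˡ-≤ (M ^ (g + b)) 2≤M ⟩
      M ^ exponent s k                       ≡⟨ ^-*-assoc 2 E (exponent s k) ⟩
      2 ^ (E * exponent s k)                 ≤⟨ ^-monoʳ-≤ 2 (*-monoˡ-≤ (exponent s k) small) ⟩
      2 ^ (2 ^ suc s * suc t * exponent s k) ≡⟨ cong (2 ^_) (xy∙z≈xz∙y (2 ^ suc s) (suc t) (exponent s k)) ⟩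
      2 ^ (2 ^ suc s * exponent s k * suc t) ∎))
    where
    open ≤-Reasoning
    E M g b : ℕ
    E = suc S ^ suc s
    M = 2 ^ E
    g = growth s (suc k)
    b = s + k
    S<E : suc S ≤ E
    S<E = ≤-trans (≤-reflexive (sym (*-identityʳ (suc S)))) (*-monoʳ-≤ (suc S) (m^n>0 (suc S) s))
    instance
      M≢0 : NonZero M
      M≢0 = m^n≢0 2 E
    S<M : suc S ℕ.< M
    S<M = <-≤-trans (n<2^n (suc S)) (^-monoʳ-≤ 2 S<E)
    2≤M : 2 ≤ M
    2≤M = ≤-trans (s≤s (s≤s z≤n)) S<M
    fits : n ≤ M ^ suc S
    fits = begin
      n                          ≤⟨ n≤2^⌈log₂n⌉ n ⟩
      2 ^ ⌈log₂ n ⌉              ≤⟨ ^-monoʳ-≤ 2 up ⟩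
      2 ^ (suc S * E)            ≡⟨ cong (2 ^_) (*-comm (suc S) E) ⟩
      2 ^ (E * suc S)            ≡⟨ sym (^-*-assoc 2 E (suc S)) ⟩
      M ^ suc S                  ∎
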